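{- For every integer $g\ge 3$, the order of a $[1,2;g]$-mixed cage is $\frac{g^2+1}{2}$ if $g$ is odd and $\frac{g^2}{2}$ if $g$ is even.
   Context: A mixed graph is a finite simple graph that may contain both edges and arcs. A $[z,r;g]$-mixed graph is a mixed graph in which every vertex is the tail of exactly $z$ arcs, the head of exactly $z$ arcs, and is incident with exactly $r$ edges, and whose girth is $g$. Walks traverse edges in either direction and arcs only in their direction; a cycle is a closed walk with no repeated vertices (other than start = end) and no repeated edge or arc; the girth is the length of a shortest cycle. A $[z,r;g]$-mixed cage is a $[z,r;g]$-mixed graph of minimum order. -}

module Defs where

open import Data.Nat.Base using (ℕ; zero; suc; _≤_; _<_)
open import Data.Fin.Base using (Fin)
open import Data.List.Base using (List; []; _∷_)
open import Data.List.Relation.Unary.AllPairs using (AllPairs)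
open import Data.List.Relation.Unary.Unique.Propositional using (Unique)
open import Data.Product.Base using (Σ; ∃; ∃₂; ∃-syntax; _×_; _,_)
open import Data.Vec.Base using (allFin; count)
open import Level using (0ℓ)
open import Relation.Binary.Core using (Rel)
open import Relation.Binary.Definitions using (Asymmetric; Decidable; Irreflexive; Symmetric)
open import Relation.Binary.PropositionalEquality.Core using (_≡_)
open import Relation.Nullary.Negation.Core using (¬_)

-- Simplicity: two vertices are joined by at most one edge or arc, and there
-- are no loops (for arcs this is a consequence of asymmetry).
record MixedGraph (n : ℕ) : Set₁ where
  field
    Edge        : Rel (Fin n) 0ℓ
    Arc         : Rel (Fin n) 0ℓ
    edge?       : Decidable Edge
    arc?        : Decidable Arc
    edge-sym    : Symmetric Edge
    edge-irrefl : Irreflexive _≡_ Edge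
    arc-asym    : Asymmetric Arc
    edge⇒¬arc   : ∀ {u v} → Edge u v → ¬ Arc u v

  outDegree inDegree edgeDegree : Fin n → ℕ
  outDegree  u = count (λ v → arc? u v) (allFin n)
  inDegree   u = count (λ v → arc? v u) (allFin n)
  edgeDegree u = count (λ v → edge? u v) (allFin n)

  data Step (u v : Fin n) : Set where
    edge : Edge u v → Step u v
    arc  : Arc u v → Step u v

  -- Two steps use the same edge (possibly in opposite directions) or the same
  -- arc; the adjacency proofs they carry are irrelevant.
  data SameLink : ∀ {u v x y} → Step u v → Step x y → Set where
    edge-same    : ∀ {u v} {e e′ : Edge u v} → SameLink (edge e) (edge e′)
    edge-flipped : ∀ {u v} {e : Edge u v} {e′ : Edge v u} → SameLink (edge e) (edge e′)
    arc-same     : ∀ {u v} {a a′ : Arc u v} → SameLink (arc a) (arc a′)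

  infixr 5 _∷_

  data Walk : Fin n → Fin n → Set where
    []  : ∀ {u} → Walk u u
    _∷_ : ∀ {u v w} → Step u v → Walk v w → Walk u w

  length : ∀ {u v} → Walk u v → ℕ
  length []      = zero
  length (_ ∷ w) = suc (length w)

  -- All vertices visited, except the final one.
  vertices : ∀ {u v} → Walk u v → List (Fin n)
  vertices []                = []
  vertices (_∷_ {u = u} _ w) = u ∷ vertices w

  steps : ∀ {u v} → Walk u v → List (∃₂ Step)
  steps []      = []
  steps (s ∷ w) = (_ , _ , s) ∷ steps w

  record IsCycle {v : Fin n} (w : Walk v v) : Set where
    field
      nonempty          : 0 < length w
      distinct-vertices : Unique (vertices w)
      distinct-links    : AllPairs (λ (_ , _ , s) (_ , _ , t) → ¬ SameLink s t) (steps w)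

  HasGirth : ℕ → Set
  HasGirth g =
      (∃[ v ] Σ (Walk v v) λ w → IsCycle w × length w ≡ g)
    × (∀ {v} (w : Walk v v) → IsCycle w → g ≤ length w)

record Is[_,_⨾_]-MixedGraph (z r g : ℕ) {n : ℕ} (G : MixedGraph n) : Set where
  open MixedGraph G
  field
    out-regular  : ∀ u → outDegree u ≡ z
    in-regular   : ∀ u → inDegree u ≡ z
    edge-regular : ∀ u → edgeDegree u ≡ r
    girth        : HasGirth g

record Is[_,_⨾_]-MixedCage (z r g : ℕ) {n : ℕ} (G : MixedGraph n) : Set₁ where
  field
    isMixedGraph : Is[ z , r ⨾ g ]-MixedGraph G
    minimal      : ∀ {m} (H : MixedGraph m) → Is[ z , r ⨾ g ]-MixedGraph H → n ≤ m

-- Cages exist and all of them have order N; the existence part keeps the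
-- statement from holding vacuously.
CageOrder[_,_⨾_] : (z r g N : ℕ) → Set₁
CageOrder[ z , r ⨾ g ] N =
    (∃ λ (G : MixedGraph N) → Is[ z , r ⨾ g ]-MixedCage G)
  × (∀ {n} (G : MixedGraph n) → Is[ z , r ⨾ g ]-MixedCage G → n ≡ N)

{-# OPTIONS --safe #-}
module Submission where

-- Put p = ⌊g/2⌋ and q = ⌈g/2⌉; the order claimed is p² + q².
--
-- Lower bound: follow the arcs from some vertex to get v₀ → v₁ → … → v_{g−1},
-- and around v_i take the edge path reaching r_i = min(i, g−1−i) steps to both
-- sides. A vertex common to the paths around v_i and v_j (i < j) would give a
-- closed walk of length at most (j − i) + r_i + r_j < g containing an arc, and
-- such a walk contains a cycle. So all Σ (2 r_i + 1) = p² + q² vertices differ.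
--
-- Construction: the vertices are the residues mod N = p² + q², with arcs
-- u → u + 1 and edges u — u ± m, where m = 2q − 1. The relations between the
-- generators 1 and m form the lattice spanned by (q , p) and (1 − q , p + 1),
-- whose shortest nonzero vectors in the ℓ¹-norm have length p + q = g.

open import Defs
open import Data.Empty using (⊥-elim)
open import Data.Fin.Base using (Fin; toℕ)
open import Data.Fin.Properties using (injective⇒≤; toℕ-injective; toℕ-fromℕ<; toℕ<n) renaming (_≟_ to _≟ᶠ_)
open import Data.List.Base as List using (List; []; _∷_; [_]; lookup; filter; applyUpTo; concat; _∷ʳ_)
open import Data.List.Membership.Propositional using (_∈_)
open import Data.List.Membership.Propositional.Properties using (∈-lookup; ∈-filter⁺; ∈-filter⁻; ∈-allFin)
import Data.List.Properties as Listₚ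
open import Data.List.Relation.Binary.Disjoint.Propositional using (Disjoint)
open import Data.List.Relation.Binary.Subset.Propositional using (_⊆_)
open import Data.List.Relation.Unary.All as All using (All; []; _∷_)
import Data.List.Relation.Unary.All.Properties as Allₚ
open import Data.List.Relation.Unary.AllPairs using (AllPairs; []; _∷_)
import Data.List.Relation.Unary.AllPairs.Properties as AllPairsₚ
open import Data.List.Relation.Unary.Any using (here; there; any?; index)
open import Data.List.Relation.Unary.Any.Properties using (lookup-index)
open import Data.List.Relation.Unary.Unique.Propositional using (Unique)
open import Data.List.Relation.Unary.Unique.Propositional.Properties using (allFin⁺; filter⁺; concat⁺)
open import Data.Nat.Base using (ℕ; zero; suc; pred; _≤_; _<_; _+_; _*_; _∸_; _⊓_; _^_; _/_; _%_; z≤n; s≤s; s≤s⁻¹; NonZero)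
open import Data.Nat.Divisibility using (_∣_; _∤_; divides)
open import Data.Nat.DivMod using (m≡m%n+[m/n]*n; m%n<n; m<n⇒m%n≡m; [m+kn]%n≡m%n; %-distribˡ-+; m%n%n≡m%n; m*n/n≡m; _mod_)
open import Data.Nat.ListAction using (sum)
open import Data.Nat.ListAction.Properties using (sum-++)
open import Data.Nat.Properties
open import Data.Nat.Tactic.RingSolver using (solve-∀)
open import Data.Product.Base using (Σ; ∃; ∃₂; ∃-syntax; _×_; _,_; proj₁; proj₂)
open import Data.Sum.Base using (_⊎_; inj₁; inj₂; [_,_]′; swap)
open import Data.Unit.Base using (⊤; tt)
import Data.Vec.Base as Vec
open import Function.Base using (_∘_; id)
open import Function.Definitions using (Injective)
open import Level using (0ℓ)
open import Relation.Binary.PropositionalEquality hiding ([_])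
open import Relation.Nullary using (¬_; yes; no; contradiction)
open import Relation.Nullary.Decidable using (_⊎-dec_)
open import Relation.Unary using (Pred; Decidable)

-- Duplicate-free lists and counting in `Fin n`.

module _ {A : Set} where

  Unique⇒lookup-injective : ∀ {xs : List A} → Unique xs → Injective _≡_ _≡_ (lookup xs)
  Unique⇒lookup-injective (_ ∷ _) {Fin.zero}  {Fin.zero}  _  = refl
  Unique⇒lookup-injective (x∉ ∷ _) {Fin.zero}  {Fin.suc j} eq = contradiction eq (All.lookup x∉ (∈-lookup j))
  Unique⇒lookup-injective (x∉ ∷ _) {Fin.suc i} {Fin.zero}  eq = contradiction (sym eq) (All.lookup x∉ (∈-lookup i))
  Unique⇒lookup-injective (_ ∷ xs!) {Fin.suc i} {Fin.suc j} eq = cong Fin.suc (Unique⇒lookup-injective xs! eq)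

  -- Pigeonhole: mapping each position in `xs` to the position of the same element in `ys` is
  -- injective.
  Unique-⊆⇒length-≤ : ∀ {xs ys : List A} → Unique xs → xs ⊆ ys → List.length xs ≤ List.length ys
  Unique-⊆⇒length-≤ {xs} {ys} xs! xs⊆ys = injective⇒≤ {f = f} λ {i} {j} eq →
    Unique⇒lookup-injective xs! (trans (lookup-index (xs⊆ys (∈-lookup i)))
      (trans (cong (lookup ys) eq) (sym (lookup-index (xs⊆ys (∈-lookup j))))))
    where
    f : Fin (List.length xs) → Fin (List.length ys)
    f i = index (xs⊆ys (∈-lookup i))

module _ {n : ℕ} {P : Pred (Fin n) 0ℓ} (P? : Decidable P) where

  -- The induction needs an arbitrary `f`, because the recursive call replaces `f` by `f ∘ Fin.suc`.
  count-tabulate : ∀ {m} (f : Fin m → Fin n) →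
                   Vec.count P? (Vec.tabulate f) ≡ List.length (filter P? (List.tabulate f))
  count-tabulate {zero}  f = refl
  count-tabulate {suc m} f with P? (f Fin.zero)
  ... | yes _ = cong suc (count-tabulate (f ∘ Fin.suc))
  ... | no  _ = count-tabulate (f ∘ Fin.suc)

  count-allFin : Vec.count P? (Vec.allFin n) ≡ List.length (filter P? (List.allFin n))
  count-allFin = count-tabulate id

  filter-allFin! : Unique (filter P? (List.allFin n))
  filter-allFin! = filter⁺ P? (allFin⁺ n)

  -- The filtered list and `xs` are duplicate-free with the same members, so each fits into the
  -- other. The degrees of the circulant graph are computed this way.
  count≡length : ∀ {xs} → Unique xs → (∀ {x} → x ∈ xs → P x) → (∀ {x} → P x → x ∈ xs) →
                 Vec.count P? (Vec.allFin n) ≡ List.length xs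
  count≡length xs! sound complete = trans count-allFin (≤-antisym
    (Unique-⊆⇒length-≤ filter-allFin! (complete ∘ proj₂ ∘ ∈-filter⁻ P? {xs = List.allFin n}))
    (Unique-⊆⇒length-≤ xs! (λ x∈ → ∈-filter⁺ P? (∈-allFin _) (sound x∈))))

  count≡1⇒∃ : Vec.count P? (Vec.allFin n) ≡ 1 → ∃ P
  count≡1⇒∃ c with filter P? (List.allFin n) in eq | trans (sym count-allFin) c
  ... | x ∷ [] | refl = x , proj₂ (∈-filter⁻ P? {xs = List.allFin n} (subst (x ∈_) (sym eq) (here refl)))

  count≡2⇒∃₂ : Vec.count P? (Vec.allFin n) ≡ 2 → ∃₂ λ x y → P x × P y × x ≢ y
  count≡2⇒∃₂ c with filter P? (List.allFin n) in eq | trans (sym count-allFin) c | filter-allFin!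
  ... | x ∷ y ∷ [] | refl | ((x≢y ∷ []) ∷ _) = x , y , sat (here refl) , sat (there (here refl)) , x≢y
    where
    sat : ∀ {z} → z ∈ x ∷ y ∷ [] → P z
    sat z∈ = proj₂ (∈-filter⁻ P? {xs = List.allFin n} (subst (_ ∈_) (sym eq) z∈))

-- Walks, loop erasure and the extraction of cycles.

module Walks {n : ℕ} (G : MixedGraph n) where
  open MixedGraph G

  private variable
    u v w x : Fin n

  infixr 5 _++_

  _++_ : Walk u v → Walk v w → Walk u w
  []      ++ q = q
  (s ∷ p) ++ q = s ∷ (p ++ q)

  length-++ : (p : Walk u v) (q : Walk v w) → length (p ++ q) ≡ length p + length q
  length-++ []      q = refl
  length-++ (s ∷ p) q = cong suc (length-++ p q)

  -- An arc cannot be traversed back, so a closed walk containing one is more than edges run back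
  -- and forth; this is what certifies that it contains a cycle.
  data HasArc : Walk u v → Set where
    here  : {a : Arc u v} {p : Walk v w} → HasArc (arc a ∷ p)
    there : {s : Step u v} {p : Walk v w} → HasArc p → HasArc (s ∷ p)

  HasArc-++⁺ˡ : {p : Walk u v} {q : Walk v w} → HasArc p → HasArc (p ++ q)
  HasArc-++⁺ˡ here      = here
  HasArc-++⁺ˡ (there h) = there (HasArc-++⁺ˡ h)

  HasArc-++⁺ʳ : (p : Walk u v) {q : Walk v w} → HasArc q → HasArc (p ++ q)
  HasArc-++⁺ʳ []      h = h
  HasArc-++⁺ʳ (s ∷ p) h = there (HasArc-++⁺ʳ p h)

  HasArc-++⁻ : (p : Walk u v) {q : Walk v w} → HasArc (p ++ q) → HasArc p ⊎ HasArc q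
  HasArc-++⁻ []      h         = inj₂ h
  HasArc-++⁻ (_ ∷ p) here      = inj₁ here
  HasArc-++⁻ (_ ∷ p) (there h) = [ inj₁ ∘ there , inj₂ ]′ (HasArc-++⁻ p h)

  visited : Walk u v → List (Fin n)
  visited {u} []      = [ u ]
  visited {u} (s ∷ p) = u ∷ visited p

  length-visited : (p : Walk u v) → List.length (visited p) ≡ suc (length p)
  length-visited []      = refl
  length-visited (s ∷ p) = cong suc (length-visited p)

  vertices⊆visited : (p : Walk u v) → vertices p ⊆ visited p
  vertices⊆visited (s ∷ p) (here eq)  = here eq
  vertices⊆visited (s ∷ p) (there x∈) = there (vertices⊆visited p x∈)

  start∈visited : (p : Walk u v) → u ∈ visited p
  start∈visited []      = here refl
  start∈visited (s ∷ p) = here refl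

  end∈visited : (p : Walk u v) → v ∈ visited p
  end∈visited []      = here refl
  end∈visited (s ∷ p) = there (end∈visited p)

  Simple : Walk u v → Set
  Simple p = Unique (visited p)

  -- When a step from `x` enters the start of `p`, it closes up with `before` to a loop at `x`, and
  -- `after` is what remains once that loop is removed.
  record Split (p : Walk u v) (x : Fin n) : Set where
    field
      before        : Walk u x
      after         : Walk x v
      recombine     : before ++ after ≡ p
      before-simple : Simple before
      after-simple  : Simple after
      before⊆       : visited before ⊆ visited p

  split : (p : Walk u v) → Simple p → x ∈ visited p → Split p x
  split []      p! (here refl) = record
    { before = [] ; after = [] ; recombine = refl ; before-simple = p! ; after-simple = p! ; before⊆ = id }
  split (s ∷ p) p! (here refl) = record
    { before = [] ; after = s ∷ p ; recombine = refl ; before-simple = [] ∷ [] ; after-simple = p!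
    ; before⊆ = λ { (here eq) → here eq } }
  split (s ∷ p) (u∉ ∷ p!) (there x∈) = record
    { before = s ∷ before ; after = after ; recombine = cong (s ∷_) recombine
    ; before-simple = All.tabulate (All.lookup u∉ ∘ before⊆) ∷ before-simple
    ; after-simple = after-simple
    ; before⊆ = λ { (here eq) → here eq ; (there y∈) → there (before⊆ y∈) } }
    where open Split (split p p! x∈)

  Distinct : ∃₂ Step → ∃₂ Step → Set
  Distinct (_ , _ , s) (_ , _ , t) = ¬ SameLink s t

  tail∈vertices : (p : Walk u v) {y z : Fin n} {t : Step y z} → (y , z , t) ∈ steps p → y ∈ vertices p
  tail∈vertices (_ ∷ p) (here refl) = here refl
  tail∈vertices (_ ∷ p) (there t∈)  = there (tail∈vertices p t∈)

  head∈visited : (p : Walk u v) {y z : Fin n} {t : Step y z} → (y , z , t) ∈ steps p → z ∈ visited p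
  head∈visited (_ ∷ p) (here refl) = there (start∈visited p)
  head∈visited (_ ∷ p) (there t∈)  = there (head∈visited p t∈)

  data IsEdge : Step u v → Set where
    isEdge : {e : Edge u v} → IsEdge (edge e)

  sameLink⇒ends : {y z : Fin n} {s : Step u v} {t : Step y z} → SameLink s t →
                  u ≡ y ⊎ (u ≡ z × v ≡ y × IsEdge s × IsEdge t)
  sameLink⇒ends edge-same    = inj₁ refl
  sameLink⇒ends edge-flipped = inj₂ (refl , refl , isEdge , isEdge)
  sameLink⇒ends arc-same     = inj₁ refl

  -- A later copy of the first link would visit `u` again, as its tail or, if the edge is reversed,
  -- as its head.
  simple⇒distinct-links : (p : Walk u v) → Simple p → AllPairs Distinct (steps p)
  simple⇒distinct-links []      _         = []
  simple⇒distinct-links (s ∷ p) (u∉ ∷ p!) = All.tabulate differ ∷ simple⇒distinct-links p p!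
    where
    differ : ∀ {t} → t ∈ steps p → Distinct (_ , _ , s) t
    differ t∈ same with sameLink⇒ends same
    ... | inj₁ refl       = All.lookup u∉ (vertices⊆visited p (tail∈vertices p t∈)) refl
    ... | inj₂ (refl , _) = All.lookup u∉ (head∈visited p t∈) refl

  simple⇒unique-vertices : (p : Walk u v) → Simple p → Unique (v ∷ vertices p)
  simple⇒unique-vertices []      _         = [] ∷ []
  simple⇒unique-vertices (s ∷ p) (u∉ ∷ p!) with simple⇒unique-vertices p p!
  ... | v∉ ∷ vs! = ((λ v≡u → All.lookup u∉ (end∈visited p) (sym v≡u)) ∷ v∉)
                 ∷ (All.tabulate (All.lookup u∉ ∘ vertices⊆visited p) ∷ vs!)

  -- The only way to close up a simple path without obtaining a cycle is to
  -- run through a single edge back and forth.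
  close : (s : Step u v) (p : Walk v u) → Simple p → HasArc (s ∷ p) ⊎ length p ≢ 1 → IsCycle (s ∷ p)
  close {u} {v} s p p! proper = record
    { nonempty          = s≤s z≤n
    ; distinct-vertices = simple⇒unique-vertices p p!
    ; distinct-links    = All.tabulate (differ s p p! proper) ∷ simple⇒distinct-links p p!
    }
    where
    differ : ∀ {u v} (s : Step u v) (p : Walk v u) → Simple p → HasArc (s ∷ p) ⊎ length p ≢ 1 →
             ∀ {t} → t ∈ steps p → Distinct (_ , _ , s) t
    differ s p p! proper t∈ same with sameLink⇒ends same
    ... | inj₁ refl with simple⇒unique-vertices p p!
    ...   | u∉ ∷ _ = All.lookup u∉ (tail∈vertices p t∈) refl
    -- A reversed copy of `s` leaves `v` and enters `u`, so by simplicity it is both the first and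
    -- the last step of the path.
    differ s (t ∷ p) (v∉ ∷ _) proper (there t∈) same | inj₂ (refl , refl , _) =
      All.lookup v∉ (vertices⊆visited p (tail∈vertices p t∈)) refl
    differ s (t ∷ []) p! (inj₂ ≢1) (here refl) same | inj₂ (refl , refl , _) = ≢1 refl
    differ s (t ∷ []) p! (inj₁ (there (there ()))) (here refl) same | inj₂ (refl , refl , isEdge , isEdge)
    differ s (t ∷ r ∷ p) (_ ∷ v∉ ∷ _) proper (here refl) same | inj₂ (refl , refl , _) =
      All.lookup v∉ (end∈visited p) refl

  ShortCycle : ℕ → Set
  ShortCycle ℓ = ∃[ v ] Σ (Walk v v) λ c → IsCycle c × length c ≤ ℓ

  weaken : ∀ {k ℓ} → k ≤ ℓ → ShortCycle k → ShortCycle ℓ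
  weaken k≤ℓ (v , c , cyc , ≤k) = v , c , cyc , ≤-trans ≤k k≤ℓ

  -- Induction from the end of the walk. If the new step closes a loop with the simple remainder, a
  -- loop with an arc is already a cycle, while an arcless loop can be cut out without losing an
  -- arc.
  eraseLoops : (p : Walk u v) → ShortCycle (length p) ⊎
             Σ (Walk u v) λ q → Simple q × length q ≤ length p × (HasArc p → HasArc q)
  eraseLoops []      = inj₂ ([] , [] ∷ [] , z≤n , id)
  eraseLoops {u} (s ∷ p) with eraseLoops p
  ... | inj₁ c = inj₁ (weaken (n≤1+n _) c)
  ... | inj₂ (q , q! , q≤p , arcs) with any? (u ≟ᶠ_) (visited q)
  ...   | no u∉ = inj₂ (s ∷ q , Allₚ.¬Any⇒All¬ _ u∉ ∷ q! , s≤s q≤p , λ { here → here ; (there h) → there (arcs h) })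
  ...   | yes u∈ = erase (hasArc? (s ∷ before))
    where
    open Split (split q q! u∈)
    hasArc? : ∀ {u v} (p : Walk u v) → HasArc p ⊎ ¬ HasArc p
    hasArc? []           = inj₂ λ ()
    hasArc? (arc _ ∷ _)  = inj₁ here
    hasArc? (edge _ ∷ p) = [ inj₁ ∘ there , (λ ¬h → inj₂ λ { (there h) → ¬h h }) ]′ (hasArc? p)
    lengths : length before + length after ≤ length p
    lengths = ≤-trans (≤-reflexive (trans (sym (length-++ before after)) (cong length recombine))) q≤p
    survives : ¬ HasArc (s ∷ before) → HasArc (s ∷ p) → HasArc after
    survives ¬h here      = ⊥-elim (¬h here)
    survives ¬h (there h) with HasArc-++⁻ before (subst HasArc (sym recombine) (arcs h))
    ... | inj₁ b = ⊥-elim (¬h (there b))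
    ... | inj₂ a = a
    erase : HasArc (s ∷ before) ⊎ ¬ HasArc (s ∷ before) → _
    erase (inj₁ h)  = inj₁ (_ , s ∷ before , close s before before-simple (inj₁ h) ,
                            s≤s (≤-trans (m≤m+n _ _) lengths))
    erase (inj₂ ¬h) = inj₂ (after , after-simple , m≤n⇒m≤1+n (≤-trans (m≤n+m _ _) lengths) , survives ¬h)

  -- Loop erasure must have met a cycle: otherwise it would keep the arc, but a simple closed walk
  -- is empty.
  closed-with-arc⇒cycle : (p : Walk u u) → HasArc p → ShortCycle (length p)
  closed-with-arc⇒cycle p h with eraseLoops p
  ... | inj₁ c = c
  ... | inj₂ (q , q! , _ , arcs) = ⊥-elim (absurd q q! (arcs h))
    where
    absurd : ∀ {u} (q : Walk u u) → Simple q → ¬ HasArc q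
    absurd (s ∷ q) (u∉ ∷ _) _ = All.lookup u∉ (end∈visited q) refl

  -- Only the first move is tested, so that `NonBacktracking` forbids just the immediate return to
  -- the previous vertex.
  Avoids : Fin n → Walk u v → Set
  Avoids x []            = ⊤
  Avoids x (_∷_ {v = v} s p) = x ≢ v

  NonBacktracking : Walk u v → Set
  NonBacktracking []              = ⊤
  NonBacktracking {u} (s ∷ p) = Avoids u p × NonBacktracking p

  -- The first repetition, seen from the end, closes a loop onto a simple path. The loop does not
  -- have length two, as that would be a backtrack, so `close` applies.
  nonBacktracking⇒simple : (p : Walk u v) → NonBacktracking p → ShortCycle (length p) ⊎ Simple p
  nonBacktracking⇒simple []          _          = inj₂ ([] ∷ [])
  nonBacktracking⇒simple {u} (s ∷ p) (avoid , nb) with nonBacktracking⇒simple p nb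
  ... | inj₁ c  = inj₁ (weaken (n≤1+n _) c)
  ... | inj₂ p! with any? (u ≟ᶠ_) (visited p)
  ...   | no u∉  = inj₂ (Allₚ.¬Any⇒All¬ _ u∉ ∷ p!)
  ...   | yes u∈ = inj₁ (_ , s ∷ before , close s before before-simple (inj₂ (≢1 before avoid′)) ,
                         s≤s (≤-trans (m≤m+n _ _) (≤-reflexive
                           (trans (sym (length-++ before after)) (cong length recombine)))))
    where
    open Split (split p p! u∈)
    avoid′ : Avoids u (before ++ after)
    avoid′ = subst (Avoids u) (sym recombine) avoid
    ≢1 : ∀ {v w} (b : Walk v u) {a : Walk u w} → Avoids u (b ++ a) → length b ≢ 1
    ≢1 (_ ∷ []) u≢u _ = u≢u refl

-- Evaluating the lower bound as a sum.

length-concat-applyUpTo : ∀ {A : Set} (f : ℕ → List A) n →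
                          List.length (concat (applyUpTo f n)) ≡ sum (applyUpTo (List.length ∘ f) n)
length-concat-applyUpTo f zero    = refl
length-concat-applyUpTo f (suc n) =
  trans (Listₚ.length-++ (f 0)) (cong (List.length (f 0) +_) (length-concat-applyUpTo (f ∘ suc) n))

-- The case `c = 0` doubles as pointwise congruence of sums.
sum-applyUpTo-shift : ∀ c {f h : ℕ → ℕ} n → (∀ {i} → i < n → f i ≡ c + h i) →
                      sum (applyUpTo f n) ≡ n * c + sum (applyUpTo h n)
sum-applyUpTo-shift c zero    eq = refl
sum-applyUpTo-shift c {f} {h} (suc n) eq = begin
  f 0 + sum (applyUpTo (f ∘ suc) n)                     ≡⟨ cong₂ _+_ (eq (s≤s z≤n)) (sum-applyUpTo-shift c n (eq ∘ s≤s)) ⟩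
  (c + h 0) + (n * c + sum (applyUpTo (h ∘ suc) n))     ≡⟨ rearrange c (h 0) (n * c) _ ⟩
  c + n * c + (h 0 + sum (applyUpTo (h ∘ suc) n))       ∎
  where
  open ≡-Reasoning
  rearrange : ∀ a b c d → (a + b) + (c + d) ≡ a + c + (b + d)
  rearrange = solve-∀

radius : ℕ → ℕ → ℕ
radius g i = i ⊓ (g ∸ suc i)

rowLength : ℕ → ℕ → ℕ
rowLength g i = suc (radius g i + radius g i)

mooreBound : ℕ → ℕ
mooreBound g = sum (applyUpTo (rowLength g) g)

-- The two outermost rows have radius 0 and contribute 1 each; each of the `g` rows between them is
-- a row for girth `g` with its radius increased by one.
mooreBound-+2 : ∀ g → mooreBound (2 + g) ≡ 2 * g + 2 + mooreBound g
mooreBound-+2 g = begin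
  1 + sum (applyUpTo inner (suc g))          ≡⟨ cong (suc ∘ sum) (Listₚ.applyUpTo-∷ʳ inner g) ⟨
  1 + sum (applyUpTo inner g ∷ʳ inner g)     ≡⟨ cong suc (sum-++ (applyUpTo inner g) [ inner g ]) ⟩
  1 + (sum (applyUpTo inner g) + (inner g + 0))
    ≡⟨ cong₂ (λ a r → 1 + (a + (suc (r + r) + 0))) (sum-applyUpTo-shift 2 g widen) last-radius ⟩
  1 + ((g * 2 + mooreBound g) + 1)           ≡⟨ rearrange g (mooreBound g) ⟩
  2 * g + 2 + mooreBound g                   ∎
  where
  open ≡-Reasoning
  inner : ℕ → ℕ
  inner i = rowLength (2 + g) (suc i)
  last-radius : radius (2 + g) (suc g) ≡ 0
  last-radius = trans (cong (suc g ⊓_) (n∸n≡0 g)) (⊓-zeroʳ (suc g))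
  widen : ∀ {i} → i < g → inner i ≡ 2 + rowLength g i
  widen {i} i<g = trans (cong (λ d → suc ((suc i ⊓ d) + (suc i ⊓ d))) (+-∸-assoc 1 i<g))
                        (cong (suc ∘ suc) (+-suc (radius g i) (radius g i)))
  rearrange : ∀ g b → 1 + ((g * 2 + b) + 1) ≡ 2 * g + 2 + b
  rearrange = solve-∀

mooreBound-even : ∀ p → mooreBound (p + p) ≡ p * p + p * p
mooreBound-even zero    = refl
mooreBound-even (suc p) = begin
  mooreBound (suc p + suc p)                   ≡⟨ cong (mooreBound ∘ suc) (+-suc p p) ⟩
  mooreBound (2 + (p + p))                     ≡⟨ mooreBound-+2 (p + p) ⟩
  2 * (p + p) + 2 + mooreBound (p + p)         ≡⟨ cong (2 * (p + p) + 2 +_) (mooreBound-even p) ⟩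
  2 * (p + p) + 2 + (p * p + p * p)            ≡⟨ rearrange p ⟩
  suc p * suc p + suc p * suc p                ∎
  where
  open ≡-Reasoning
  rearrange : ∀ p → 2 * (p + p) + 2 + (p * p + p * p) ≡ suc p * suc p + suc p * suc p
  rearrange = solve-∀

mooreBound-odd : ∀ p → mooreBound (p + suc p) ≡ p * p + suc p * suc p
mooreBound-odd zero    = refl
mooreBound-odd (suc p) = begin
  mooreBound (suc p + suc (suc p))             ≡⟨ cong (mooreBound ∘ suc) (+-suc p (suc p)) ⟩
  mooreBound (2 + (p + suc p))                 ≡⟨ mooreBound-+2 (p + suc p) ⟩
  2 * (p + suc p) + 2 + mooreBound (p + suc p) ≡⟨ cong (2 * (p + suc p) + 2 +_) (mooreBound-odd p) ⟩
  2 * (p + suc p) + 2 + (p * p + suc p * suc p) ≡⟨ rearrange p ⟩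
  suc p * suc p + suc (suc p) * suc (suc p)    ∎
  where
  open ≡-Reasoning
  rearrange : ∀ p → 2 * (p + suc p) + 2 + (p * p + suc p * suc p) ≡ suc p * suc p + suc (suc p) * suc (suc p)
  rearrange = solve-∀

-- The lower bound: disjoint edge paths around the vertices of an arc walk.

module LowerBound {n g : ℕ} (G : MixedGraph n) (regular : Is[ 1 , 2 ⨾ g ]-MixedGraph G) where
  open MixedGraph G
  open Walks G
  open Is[_,_⨾_]-MixedGraph regular

  private variable
    u v a b x y : Fin n
    r t : ℕ

  no-short-cycle : ∀ {ℓ} → ShortCycle ℓ → ¬ ℓ < g
  no-short-cycle (_ , c , cyc , ≤ℓ) ℓ<g = <⇒≱ (≤-<-trans ≤ℓ ℓ<g) (proj₂ girth c cyc)

  successor : ∀ u → ∃ λ v → Arc u v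
  successor u = count≡1⇒∃ (arc? u) (out-regular u)

  -- Degree two lets an edge path always continue without turning back.
  neighbour-avoiding : ∀ u x → ∃ λ v → Edge u v × x ≢ v
  neighbour-avoiding u x with count≡2⇒∃₂ (edge? u) (edge-regular u)
  ... | v , w , ev , ew , v≢w with x ≟ᶠ v
  ...   | no x≢v   = v , ev , x≢v
  ...   | yes refl = w , ew , v≢w

  -- The index bounds the number of edges instead of fixing it, so that one radius fits all vertices
  -- of a row.
  data Near (u : Fin n) : ℕ → Fin n → Set where
    centre : Near u r u
    step   : Near u r x → Edge x y → Near u (suc r) y

  near-mono : t ≤ r → Near u t x → Near u r x
  near-mono _         centre     = centre
  near-mono (s≤s t≤r) (step p e) = step (near-mono t≤r p) e

  near⇒walk-from : Near u r x → Σ (Walk u x) λ p → length p ≤ r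
  near⇒walk-from centre = [] , z≤n
  near⇒walk-from (step p e) with near⇒walk-from p
  ... | q , q≤ = q ++ (edge e ∷ []) ,
    ≤-trans (≤-reflexive (trans (length-++ q _) (+-comm (length q) 1))) (s≤s q≤)

  near⇒walk-to : Near u r x → Σ (Walk x u) λ p → length p ≤ r
  near⇒walk-to centre = [] , z≤n
  near⇒walk-to (step p e) with near⇒walk-to p
  ... | q , q≤ = edge (edge-sym e) ∷ q , s≤s q≤

  -- At most `t` edges separate `a` from the centre and `s` are still to be taken; `c` is the vertex
  -- just left, which the first new edge has to avoid.
  forward : ∀ s {a} c → Near u t a → t + s ≤ r →
            ∃ λ b → Σ (Walk a b) λ w →
              length w ≡ s × NonBacktracking w × Avoids c w × All (Near u r) (visited w)
  forward {t = t} zero c near t≤r = _ , [] , refl , tt , tt , near-mono (≤-trans (m≤m+n t 0) t≤r) near ∷ []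
  forward {t = t} (suc s) {a} c near t+s≤r with neighbour-avoiding a c
  ... | b , e , c≢b with forward s a (step near e) (≤-trans (≤-reflexive (sym (+-suc t s))) t+s≤r)
  ...   | z , w , len , nb , avoid , all =
    z , edge e ∷ w , cong suc len , (avoid , nb) , c≢b , near-mono (≤-trans (m≤m+n t _) t+s≤r) near ∷ all

  predecessor-avoiding : (w : Walk a b) → ∃ λ x → Edge a x × Avoids x w
  predecessor-avoiding {a} [] with neighbour-avoiding a a
  ... | x , e , _ = x , e , tt
  predecessor-avoiding {a} (_∷_ {v = v} s w) with neighbour-avoiding a v
  ... | x , e , v≢x = x , e , v≢x ∘ sym

  -- The path grows at its start. Each new edge avoids the second vertex of the path so far, so the
  -- junction with the forward half does not backtrack either.
  backward : ∀ s {a b} (w : Walk a b) → NonBacktracking w → All (Near u r) (visited w) →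
             Near u t a → t + s ≤ r →
             ∃₂ λ a b → Σ (Walk a b) λ w′ →
               length w′ ≡ s + length w × NonBacktracking w′ × All (Near u r) (visited w′)
  backward zero    w nb all near t≤r = _ , _ , w , refl , nb , all
  backward {t = t} (suc s) w nb all near t+s≤r with predecessor-avoiding w
  ... | x , e , avoid with backward s (edge (edge-sym e) ∷ w) (avoid , nb)
                             (near-mono (≤-trans (m≤m+n (suc t) s) t+s≤r′) (step near e) ∷ all) (step near e) t+s≤r′
    where t+s≤r′ = ≤-trans (≤-reflexive (sym (+-suc t s))) t+s≤r
  ...   | a , b , w′ , len , nb′ , all′ = a , b , w′ , trans len (+-suc s (length w)) , nb′ , all′

  -- The two halves join to a non-backtracking walk of `r + r` edges; a repeated vertex would yield
  -- a cycle shorter than `g`.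
  row : ∀ u r → r + r < g →
        Σ (List (Fin n)) λ xs → List.length xs ≡ suc (r + r) × Unique xs × All (Near u r) xs
  -- No vertex precedes `u` yet; `u` itself is the default value to avoid.
  row u r 2r<g with forward {t = 0} r u centre ≤-refl
  ... | _ , w , len , nb , _ , all with backward {t = 0} r w nb all centre ≤-refl
  ...   | _ , _ , w′ , len′ , nb′ , all′ =
    visited w′ , trans (length-visited w′) (cong suc len″) , simple , all′
    where
    len″ : length w′ ≡ r + r
    len″ = trans len′ (cong (r +_) len)
    simple : Simple w′
    simple = [ (λ c → contradiction (≤-<-trans (≤-reflexive len″) 2r<g) (no-short-cycle c)) , id ]′
               (nonBacktracking⇒simple w′ nb′)

  orbit : ℕ → Fin n
  -- The cycle that attains the girth supplies a starting vertex.
  orbit zero    = proj₁ (proj₁ girth)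
  orbit (suc i) = proj₁ (successor (orbit i))

  arcs-along-orbit : ∀ i k → Σ (Walk (orbit i) (orbit (suc k + i))) λ p → length p ≡ suc k × HasArc p
  arcs-along-orbit i zero    = arc (proj₂ (successor (orbit i))) ∷ [] , refl , here
  arcs-along-orbit i (suc k) with arcs-along-orbit i k
  ... | p , len , h = p ++ (arc (proj₂ (successor _)) ∷ []) ,
    trans (length-++ p _) (trans (+-comm (length p) 1) (cong suc len)) , HasArc-++⁺ˡ h

  -- The closed walk follows the arcs from `orbit i` to `orbit j`, goes out to `x` and returns to
  -- `orbit i`. Since `i < j` it contains an arc, hence a cycle shorter than `g`.
  near-orbit-disjoint : ∀ {i j s t} → i < j → (j ∸ i) + (t + s) < g →
                        Near (orbit i) s x → ¬ Near (orbit j) t x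
  near-orbit-disjoint {x = x} {i} {j} {s} {t} i<j short near-i near-j =
    no-short-cycle (closed-with-arc⇒cycle loop loop-arc) loop-short
    where
    -- One less than the number of arcs, to match `suc k` in `arcs-along-orbit`.
    k = j ∸ suc i
    suck≡ : suc k ≡ j ∸ i
    suck≡ = sym (+-∸-assoc 1 i<j)
    k+i≡j : suc k + i ≡ j
    k+i≡j = trans (cong (_+ i) suck≡) (m∸n+n≡m (<⇒≤ i<j))
    along = arcs-along-orbit i k
    out   = near⇒walk-from (subst (λ j → Near (orbit j) t x) (sym k+i≡j) near-j)
    back  = near⇒walk-to near-i
    loop : Walk (orbit i) (orbit i)
    loop = proj₁ along ++ proj₁ out ++ proj₁ back
    loop-arc : HasArc loop
    loop-arc = HasArc-++⁺ˡ (proj₂ (proj₂ along))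
    loop-short : length loop < g
    loop-short = ≤-<-trans (≤-trans (≤-reflexive (trans (length-++ (proj₁ along) _)
        (cong₂ _+_ (trans (proj₁ (proj₂ along)) suck≡) (length-++ (proj₁ out) (proj₁ back)))))
      (+-monoʳ-≤ (j ∸ i) (+-mono-≤ (proj₂ out) (proj₂ back)))) short

  radius-short : ∀ i → i < g → radius g i + radius g i < g
  radius-short i i<g = ≤-trans (s≤s (+-mono-≤ (m⊓n≤m i (g ∸ suc i)) (m⊓n≤n i (g ∸ suc i)))) (≤-reflexive (m+[n∸m]≡n i<g))

  -- Bounding the radius at `j` by `g ∸ suc j` and the one at `i` by `i` makes the sum telescope to
  -- `g ∸ 1`.
  radii-short : ∀ {i j} → i < j → j < g → (j ∸ i) + (radius g j + radius g i) < g
  radii-short {i} {j} i<j j<g = begin-strict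
    (j ∸ i) + (radius g j + radius g i)  ≤⟨ +-monoʳ-≤ (j ∸ i) (+-mono-≤ (m⊓n≤n j (g ∸ suc j)) (m⊓n≤m i (g ∸ suc i))) ⟩
    (j ∸ i) + ((g ∸ suc j) + i)          ≡⟨ cong ((j ∸ i) +_) (+-comm (g ∸ suc j) i) ⟩
    (j ∸ i) + (i + (g ∸ suc j))          ≡⟨ +-assoc (j ∸ i) i (g ∸ suc j) ⟨
    (j ∸ i) + i + (g ∸ suc j)            ≡⟨ cong (_+ (g ∸ suc j)) (m∸n+n≡m (<⇒≤ i<j)) ⟩
    j + (g ∸ suc j)                      <⟨ ≤-reflexive (m+[n∸m]≡n j<g) ⟩
    g                                    ∎
    where open ≤-Reasoning

  -- Rows are indexed by all of ℕ so that applyUpTo applies; beyond g they are empty.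
  rows : ℕ → List (Fin n)
  rows i with i <? g
  ... | yes i<g = proj₁ (row (orbit i) (radius g i) (radius-short i i<g))
  ... | no _    = []

  rows-length : ∀ {i} → i < g → List.length (rows i) ≡ rowLength g i
  rows-length {i} i<g with i <? g
  ... | yes i<g = proj₁ (proj₂ (row (orbit i) (radius g i) (radius-short i i<g)))
  ... | no i≮g  = contradiction i<g i≮g

  rows-unique : ∀ {i} → i < g → Unique (rows i)
  rows-unique {i} i<g with i <? g
  ... | yes i<g = proj₁ (proj₂ (proj₂ (row (orbit i) (radius g i) (radius-short i i<g))))
  ... | no i≮g  = contradiction i<g i≮g

  rows-near : ∀ {i} → i < g → All (Near (orbit i) (radius g i)) (rows i)
  rows-near {i} i<g with i <? g
  ... | yes i<g = proj₂ (proj₂ (proj₂ (row (orbit i) (radius g i) (radius-short i i<g))))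
  ... | no i≮g  = contradiction i<g i≮g

  rows-disjoint : ∀ {i j} → i < j → j < g → Disjoint (rows i) (rows j)
  rows-disjoint i<j j<g (x∈i , x∈j) = near-orbit-disjoint i<j (radii-short i<j j<g)
    (All.lookup (rows-near (<-trans i<j j<g)) x∈i) (All.lookup (rows-near j<g) x∈j)

  mooreBound≤order : mooreBound g ≤ n
  mooreBound≤order = begin
    mooreBound g                                 ≡⟨ sum-applyUpTo-shift 0 g (sym ∘ rows-length) ⟩
    g * 0 + sum (applyUpTo (List.length ∘ rows) g) ≡⟨ cong (_+ sum (applyUpTo (List.length ∘ rows) g)) (*-zeroʳ g) ⟩
    sum (applyUpTo (List.length ∘ rows) g)       ≡⟨ length-concat-applyUpTo rows g ⟨
    List.length (concat (applyUpTo rows g))      ≤⟨ Unique-⊆⇒length-≤ all! (λ {x} _ → ∈-allFin x) ⟩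
    List.length (List.allFin n)                  ≡⟨ Listₚ.length-tabulate id ⟩
    n                                            ∎
    where
    open ≤-Reasoning
    all! : Unique (concat (applyUpTo rows g))
    all! = concat⁺ (Allₚ.applyUpTo⁺₁ rows g rows-unique) (AllPairsₚ.applyUpTo⁺₁ rows g rows-disjoint)

-- Congruences and the circulant graph.

m%o≡n%o⇒m≡n+k*o : ∀ m n o .{{_ : NonZero o}} → m % o ≡ n % o → ∃ λ k → m ≡ n + k * o ⊎ n ≡ m + k * o
m%o≡n%o⇒m≡n+k*o m n o eq =
  [ from m n (sym eq) , swap′ ∘ from n m eq ]′ (≤-total (n / o) (m / o))
  where
  swap′ : ∃ (λ k → n ≡ m + k * o ⊎ m ≡ n + k * o) → ∃ λ k → m ≡ n + k * o ⊎ n ≡ m + k * o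
  swap′ (k , e) = k , swap e
  from : ∀ m n → n % o ≡ m % o → n / o ≤ m / o → ∃ λ k → m ≡ n + k * o ⊎ n ≡ m + k * o
  from m n eq le with m≤n⇒∃[o]m+o≡n le
  ... | k , n/o+k≡m/o = k , inj₁ (begin
    m                                ≡⟨ m≡m%n+[m/n]*n m o ⟩
    m % o + (m / o) * o            ≡⟨ cong₂ (λ r d → r + d * o) (sym eq) (sym n/o+k≡m/o) ⟩
    n % o + (n / o + k) * o        ≡⟨ rearrange (n % o) (n / o) k o ⟩
    n % o + (n / o) * o + k * o    ≡⟨ cong (_+ k * o) (m≡m%n+[m/n]*n n o) ⟨
    n + k * o                        ∎)
    where
    open ≡-Reasoning
    rearrange : ∀ r d k o → r + (d + k) * o ≡ r + d * o + k * o
    rearrange = solve-∀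

-- `short` is the lattice statement: fewer than `g` steps return to their start only with no arc and
-- equally many edges up and down. The equation for `N` provides a closed walk of length `g`.
module Circulant
  (N m g p q : ℕ) {{_ : NonZero N}}
  (2<g : 2 < g) (p+1+q≡g : p + suc q ≡ g) (1+q+pm≡N : suc q + p * m ≡ N)
  (short : ∀ a b c k → a + b + c < g →
           a + b * m ≡ c * m + k * N ⊎ c * m ≡ a + b * m + k * N → a ≡ 0 × b ≡ c)
  where

  shift : ℕ → Fin N → Fin N
  shift k u = (k + toℕ u) mod N

  infixr 5 _+1⟶_ _+m⟶_ _-m⟶_

  private variable
    u v w : Fin N
    a b c : ℕ

  toℕ-shift : ∀ k u → toℕ (shift k u) ≡ (k + toℕ u) % N
  toℕ-shift k u = toℕ-fromℕ< (m%n<n (k + toℕ u) N)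

  [m+n%o]%o≡[m+n]%o : ∀ m n → (m + n % N) % N ≡ (m + n) % N
  [m+n%o]%o≡[m+n]%o m n = begin
    (m + n % N) % N          ≡⟨ %-distribˡ-+ m (n % N) N ⟩
    (m % N + n % N % N) % N  ≡⟨ cong (λ r → (m % N + r) % N) (m%n%n≡m%n n N) ⟩
    (m % N + n % N) % N      ≡⟨ %-distribˡ-+ m n N ⟨
    (m + n) % N              ∎
    where open ≡-Reasoning

  shift-+ : ∀ k l u → shift k (shift l u) ≡ shift (k + l) u
  shift-+ k l u = toℕ-injective (begin
    toℕ (shift k (shift l u))     ≡⟨ toℕ-shift k (shift l u) ⟩
    (k + toℕ (shift l u)) % N     ≡⟨ cong (λ r → (k + r) % N) (toℕ-shift l u) ⟩
    (k + (l + toℕ u) % N) % N     ≡⟨ [m+n%o]%o≡[m+n]%o k (l + toℕ u) ⟩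
    (k + (l + toℕ u)) % N         ≡⟨ cong (_% N) (+-assoc k l (toℕ u)) ⟨
    (k + l + toℕ u) % N           ≡⟨ toℕ-shift (k + l) u ⟨
    toℕ (shift (k + l) u)         ∎)
    where open ≡-Reasoning

  shift-*N : ∀ k u → shift (k * N) u ≡ u
  shift-*N k u = toℕ-injective (begin
    toℕ (shift (k * N) u)  ≡⟨ toℕ-shift (k * N) u ⟩
    (k * N + toℕ u) % N    ≡⟨ cong (_% N) (+-comm (k * N) (toℕ u)) ⟩
    (toℕ u + k * N) % N    ≡⟨ [m+kn]%n≡m%n (toℕ u) k N ⟩
    toℕ u % N              ≡⟨ m<n⇒m%n≡m (toℕ<n u) ⟩
    toℕ u                  ∎)
    where open ≡-Reasoning

  shift-0 : ∀ u → shift 0 u ≡ u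
  shift-0 = shift-*N 0

  shift-N : ∀ u → shift N u ≡ u
  shift-N u = trans (cong (λ k → shift k u) (sym (+-identityʳ N))) (shift-*N 1 u)

  -- Multiplying by `pred N` realises negation modulo `N` without integers.
  unshift : ℕ → Fin N → Fin N
  unshift k = shift (k * pred N)

  shift-unshift : ∀ k u → shift k (unshift k u) ≡ u
  shift-unshift k u = trans (shift-+ k (k * pred N) u)
    (trans (cong (λ j → shift j u) (trans (sym (*-suc k (pred N))) (cong (k *_) (suc-pred N)))) (shift-*N k u))

  unshift-shift : ∀ k u → unshift k (shift k u) ≡ u
  unshift-shift k u = trans (shift-+ (k * pred N) k u)
    (trans (cong (λ j → shift j u) (+-comm (k * pred N) k)) (trans (sym (shift-+ k (k * pred N) u)) (shift-unshift k u)))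

  shift-injective : ∀ k → shift k u ≡ shift k v → u ≡ v
  shift-injective {u} {v} k eq = trans (sym (unshift-shift k u)) (trans (cong (unshift k) eq) (unshift-shift k v))

  shift-≡⇒multiple : ∀ k l u → shift k u ≡ shift l u → ∃ λ j → k ≡ l + j * N ⊎ l ≡ k + j * N
  shift-≡⇒multiple k l u eq
    with m%o≡n%o⇒m≡n+k*o (k + toℕ u) (l + toℕ u) N (trans (sym (toℕ-shift k u)) (trans (cong toℕ eq) (toℕ-shift l u)))
  ... | j , inj₁ e = j , inj₁ (+-cancelʳ-≡ (toℕ u) k (l + j * N) (trans e (rearrange l (toℕ u) (j * N))))
    where rearrange : ∀ a b c → a + b + c ≡ a + c + b
          rearrange = solve-∀
  ... | j , inj₂ e = j , inj₂ (+-cancelʳ-≡ (toℕ u) l (k + j * N) (trans e (rearrange k (toℕ u) (j * N))))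
    where rearrange : ∀ a b c → a + b + c ≡ a + c + b
          rearrange = solve-∀

  -- v is reached from u by a steps +1, b steps +m and c steps −m, in any order.
  data Reach : (a b c : ℕ) (u v : Fin N) → Set where
    stay : Reach 0 0 0 u u
    _+1⟶_ : v ≡ shift 1 u → Reach a b c v w → Reach (suc a) b c u w
    _+m⟶_ : v ≡ shift m u → Reach a b c v w → Reach a (suc b) c u w
    _-m⟶_ : u ≡ shift m v → Reach a b c v w → Reach a b (suc c) u w

  -- Steps down are gathered on the right-hand side, which avoids subtraction.
  reach⇒shift : Reach a b c u v → shift (a + b * m) u ≡ shift (c * m) v
  reach⇒shift stay = refl
  reach⇒shift {suc a} {b} {c} {u} (refl +1⟶ r) =
    trans (trans (cong (λ k → shift k u) (+-comm 1 (a + b * m))) (sym (shift-+ (a + b * m) 1 u))) (reach⇒shift r)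
  reach⇒shift {a} {suc b} {c} {u} (refl +m⟶ r) =
    trans (trans (cong (λ k → shift k u) (rearrange a m (b * m))) (sym (shift-+ (a + b * m) m u))) (reach⇒shift r)
    where
    rearrange : ∀ a m n → a + (m + n) ≡ a + n + m
    rearrange = solve-∀
  reach⇒shift {a} {b} {suc c} {v = w} (_-m⟶_ {v = v} refl r) = begin
    shift (a + b * m) (shift m v)   ≡⟨ shift-+ (a + b * m) m v ⟩
    shift (a + b * m + m) v         ≡⟨ cong (λ k → shift k v) (+-comm (a + b * m) m) ⟩
    shift (m + (a + b * m)) v       ≡⟨ shift-+ m (a + b * m) v ⟨
    shift m (shift (a + b * m) v)   ≡⟨ cong (shift m) (reach⇒shift r) ⟩
    shift m (shift (c * m) w)       ≡⟨ shift-+ m (c * m) w ⟩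
    shift (suc c * m) w             ∎
    where open ≡-Reasoning

  short-return : Reach a b c u u → a + b + c < g → a ≡ 0 × b ≡ c
  short-return {a} {b} {c} {u} r <g with shift-≡⇒multiple (a + b * m) (c * m) u (reach⇒shift r)
  ... | k , eq = short a b c k <g eq

  no-return-1 : v ≡ shift m u → v ≢ u
  no-return-1 up refl = contradiction (proj₂ (short-return (up +m⟶ stay) (<-trans (s≤s (s≤s z≤n)) 2<g))) λ ()

  -- As two steps up do not close, the neighbours of `u` by `+m` and by `-m` are different, which
  -- makes the edge degree two and not one.
  no-return-2 : v ≡ shift m u → u ≢ shift m v
  no-return-2 up up′ = contradiction (proj₂ (short-return (up +m⟶ (up′ +m⟶ stay)) 2<g)) λ ()

  -- A violation of simplicity would be a closed walk of at most two steps that has an arc or only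
  -- goes up, which `short-return` excludes because `2 < g`.
  graph : MixedGraph N
  graph = record
    { Edge        = λ u v → v ≡ shift m u ⊎ u ≡ shift m v
    ; Arc         = λ u v → v ≡ shift 1 u
    ; edge?       = λ u v → (v ≟ᶠ shift m u) ⊎-dec (u ≟ᶠ shift m v)
    ; arc?        = λ u v → v ≟ᶠ shift 1 u
    ; edge-sym    = swap
    ; edge-irrefl = λ { refl → [ (λ e → no-return-1 e refl) , (λ e → no-return-1 e refl) ]′ }
    ; arc-asym    = λ a a′ → contradiction (proj₁ (short-return (a +1⟶ (a′ +1⟶ stay)) 2<g)) λ ()
    ; edge⇒¬arc   = λ
      { (inj₁ e) a → contradiction (proj₁ (short-return (a +1⟶ (e -m⟶ stay)) 2<g)) λ ()
      ; (inj₂ e) a → contradiction (proj₁ (short-return (a +1⟶ (e +m⟶ stay)) 2<g)) λ () }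
    }

  open MixedGraph graph
  open Walks graph

  outDegree≡1 : ∀ u → outDegree u ≡ 1
  outDegree≡1 u = count≡length (arc? u) {xs = shift 1 u ∷ []} ([] ∷ []) (λ { (here eq) → eq }) here

  inDegree≡1 : ∀ u → inDegree u ≡ 1
  inDegree≡1 u = count≡length (λ v → arc? v u) {xs = unshift 1 u ∷ []} ([] ∷ [])
    (λ { (here refl) → sym (shift-unshift 1 u) }) (λ { {v} refl → here (sym (unshift-shift 1 v)) })

  edgeDegree≡2 : ∀ u → edgeDegree u ≡ 2
  edgeDegree≡2 u = count≡length (edge? u) {xs = shift m u ∷ unshift m u ∷ []}
    (((λ eq → no-return-2 (sym eq) (sym (shift-unshift m u))) ∷ []) ∷ [] ∷ [])
    (λ { (here eq) → inj₁ eq ; (there (here refl)) → inj₂ (sym (shift-unshift m u)) })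
    (λ { (inj₁ eq) → here eq ; {v} (inj₂ refl) → there (here (sym (unshift-shift m v))) })

  arcs ups downs : Walk u v → ℕ
  arcs []                  = 0
  arcs (arc _ ∷ p)         = suc (arcs p)
  arcs (edge _ ∷ p)        = arcs p
  ups []                   = 0
  ups (edge (inj₁ _) ∷ p)  = suc (ups p)
  ups (edge (inj₂ _) ∷ p)  = ups p
  ups (arc _ ∷ p)          = ups p
  downs []                  = 0
  downs (edge (inj₁ _) ∷ p) = downs p
  downs (edge (inj₂ _) ∷ p) = suc (downs p)
  downs (arc _ ∷ p)         = downs p

  length≡arcs+ups+downs : (p : Walk u v) → length p ≡ arcs p + ups p + downs p
  length≡arcs+ups+downs []                  = refl
  length≡arcs+ups+downs (arc _ ∷ p)         = cong suc (length≡arcs+ups+downs p)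
  length≡arcs+ups+downs (edge (inj₁ _) ∷ p) =
    trans (cong suc (length≡arcs+ups+downs p)) (cong (_+ downs p) (sym (+-suc (arcs p) (ups p))))
  length≡arcs+ups+downs (edge (inj₂ _) ∷ p) =
    trans (cong suc (length≡arcs+ups+downs p)) (sym (+-suc (arcs p + ups p) (downs p)))

  walk⇒reach : (p : Walk u v) → Reach (arcs p) (ups p) (downs p) u v
  walk⇒reach []                  = stay
  walk⇒reach (arc a ∷ p)         = a +1⟶ walk⇒reach p
  walk⇒reach (edge (inj₁ e) ∷ p) = e +m⟶ walk⇒reach p
  walk⇒reach (edge (inj₂ e) ∷ p) = e -m⟶ walk⇒reach p

  -- A change of direction between consecutive edges would lead straight back along the same link,
  -- because shifting by `m` is an injective function.
  arcless⇒monotone : (p : Walk u v) → AllPairs Distinct (steps p) → arcs p ≡ 0 → ups p ≡ 0 ⊎ downs p ≡ 0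
  arcless⇒monotone []                       _ _  = inj₁ refl
  arcless⇒monotone (edge (inj₁ _) ∷ [])     _ _  = inj₂ refl
  arcless⇒monotone (edge (inj₂ _) ∷ [])     _ _  = inj₁ refl
  arcless⇒monotone (edge (inj₁ e) ∷ edge (inj₁ f) ∷ p) (_ ∷ d) a≡0 with arcless⇒monotone (edge (inj₁ f) ∷ p) d a≡0
  ... | inj₂ eq = inj₂ eq
  arcless⇒monotone (edge (inj₂ e) ∷ edge (inj₂ f) ∷ p) (_ ∷ d) a≡0 with arcless⇒monotone (edge (inj₂ f) ∷ p) d a≡0
  ... | inj₁ eq = inj₁ eq
  arcless⇒monotone (edge (inj₁ e) ∷ edge (inj₂ f) ∷ p) ((d ∷ _) ∷ _) _
    with shift-injective m (trans (sym e) f)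
  ... | refl = contradiction edge-flipped d
  arcless⇒monotone (edge (inj₂ e) ∷ edge (inj₁ f) ∷ p) ((d ∷ _) ∷ _) _
    with trans e (sym f)
  ... | refl = contradiction edge-flipped d

  -- A shorter cycle would have no arcs and equally many edges up and down; being monotone, it would
  -- have no edges at all.
  g≤cycle : (p : Walk u u) → IsCycle p → g ≤ length p
  g≤cycle p cyc = ≮⇒≥ λ <g →
    let arcs≡0 , ups≡downs = short-return (walk⇒reach p) (≤-<-trans (≤-reflexive (sym (length≡arcs+ups+downs p))) <g)
        ups≡0 = [ id , trans ups≡downs ]′ (arcless⇒monotone p distinct-links arcs≡0)
        length≡0 = trans (length≡arcs+ups+downs p)
                     (cong₂ _+_ (cong₂ _+_ arcs≡0 ups≡0) (trans (sym ups≡downs) ups≡0))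
    in contradiction (sym length≡0) (<⇒≢ nonempty)
    where open IsCycle cyc

  climb : ∀ k → v ≡ shift (k * m) u → Σ (Walk u v) λ w → length w ≡ k
  climb zero    eq with trans eq (shift-0 _)
  ... | refl = [] , refl
  climb {u = u} (suc k) eq with climb k refl
  ... | w , len = w ++ (edge (inj₁ (trans eq (sym (shift-+ m (k * m) u)))) ∷ []) ,
    trans (length-++ w _) (trans (+-comm (length w) 1) (cong suc len))

  drift : ∀ k → v ≡ shift k u → Σ (Walk u v) λ w → length w ≡ k × (NonZero k → HasArc w)
  drift zero    eq with trans eq (shift-0 _)
  ... | refl = [] , refl , λ ()
  drift {u = u} (suc k) eq with drift k refl
  ... | w , len , _ = w ++ (arc (trans eq (sym (shift-+ 1 k u))) ∷ []) ,
    trans (length-++ w _) (trans (+-comm (length w) 1) (cong suc len)) , λ _ → HasArc-++⁺ʳ w here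

  origin : Fin N
  origin = 0 mod N

  back-at-origin : shift (suc q) (shift (p * m) origin) ≡ origin
  back-at-origin = trans (shift-+ (suc q) (p * m) origin)
    (trans (cong (λ k → shift k origin) 1+q+pm≡N) (shift-N origin))

  -- `p` edges up and `suc q` arcs advance by exactly `N`, so they close; the cycle inside has
  -- length at most `g`, and `g≤cycle` makes it equal.
  girth : HasGirth g
  girth with climb {u = origin} p refl
  ... | up , up-length with drift (suc q) (sym back-at-origin)
  ...   | along , along-length , h with closed-with-arc⇒cycle (up ++ along) (HasArc-++⁺ʳ up (h _))
  ...     | v , w , cyc , ≤g =
    (v , w , cyc , ≤-antisym (≤-trans ≤g (≤-reflexive loop-length)) (g≤cycle w cyc)) , g≤cycle
    where
    loop-length : length (up ++ along) ≡ g
    loop-length = trans (length-++ up along) (trans (cong₂ _+_ up-length along-length) p+1+q≡g)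

  regular : Is[ 1 , 2 ⨾ g ]-MixedGraph graph
  regular = record
    { out-regular = outDegree≡1 ; in-regular = inDegree≡1 ; edge-regular = edgeDegree≡2 ; girth = girth }

-- Short relations between the generators 1 and `m` modulo `N`.

-- Here suc q is ⌈g/2⌉.
module Arithmetic (p q : ℕ) (1≤q : 1 ≤ q) (p≤1+q : p ≤ suc q) (q≤p : q ≤ p) where

  -- For `p = q` and for `p = suc q`, the only values allowed, `N` is the sum of the squares of `p`
  -- and `suc q`. This form displays the lattice vector of `suc q` arcs and `p` edges.
  m N g : ℕ
  m = q + suc q
  N = suc q + p * m
  g = p + suc q

  1≤m : 1 ≤ m
  1≤m = ≤-trans 1≤q (m≤m+n q (suc q))

  m≰1+q : ¬ m ≤ suc q
  m≰1+q = <⇒≱ (+-monoˡ-≤ (suc q) 1≤q)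

  m≤m*t : ∀ {t} → 1 ≤ t → m ≤ t * m
  m≤m*t 1≤t = ≤-trans (≤-reflexive (sym (*-identityˡ m))) (*-monoˡ-≤ m 1≤t)

  s≤s*m : ∀ s → s ≤ s * m
  s≤s*m s = ≤-trans (≤-reflexive (sym (*-identityʳ s))) (*-monoʳ-≤ s 1≤m)

  -- At most `p + q`, hence at most `p + p`, steps of size at most `m` are taken, and `p * m < N`.
  below-2N : ∀ a t k → a + t < g → a + t * m < suc (suc k) * N
  below-2N a t k <g = begin-strict
    a + t * m                        ≤⟨ +-monoˡ-≤ (t * m) (s≤s*m a) ⟩
    a * m + t * m                    ≡⟨ *-distribʳ-+ m a t ⟨
    (a + t) * m                      ≤⟨ *-monoˡ-≤ m a+t≤2p ⟩
    (p + p) * m                      ≡⟨ *-distribʳ-+ m p p ⟩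
    p * m + p * m                    <⟨ +-mono-<-≤ {p * m} {N} (s≤s (m≤n+m (p * m) q)) (m≤n+m (p * m) (suc q)) ⟩
    N + N                            ≤⟨ +-monoʳ-≤ N (m≤m+n N (k * N)) ⟩
    N + (N + k * N)                  ∎
    where
    open ≤-Reasoning
    a+t≤2p : a + t ≤ p + p
    a+t≤2p = ≤-trans (s≤s⁻¹ (≤-trans <g (≤-reflexive (+-suc p q)))) (+-monoʳ-≤ p q≤p)

  -- Arcs and edges pull the same way, and only `k = 1` needs care. With `t ≤ p`, each edge short of
  -- `p` is replaced by `m ≥ 1` arcs, so at least `g` steps are used; with `t > p`, a single surplus
  -- edge already exceeds the remaining `suc q`.
  aligned : ∀ a t k → a + t < g → a + t * m ≡ k * N → a ≡ 0 × t ≡ 0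
  aligned a t zero    <g eq = m+n≡0⇒m≡0 a eq , n≤0⇒n≡0 (≤-trans (s≤s*m t) (≤-reflexive (m+n≡0⇒n≡0 a {t * m} eq)))
  aligned a t (suc (suc k)) <g eq = contradiction eq (<⇒≢ (below-2N a t k <g))
  aligned a t (suc zero) <g eq with ≤-<-connex t p
  ... | inj₁ t≤p with m≤n⇒∃[o]m+o≡n t≤p
  ...   | s , refl = contradiction <g (≤⇒≯ (begin
    t + s + suc q        ≡⟨ rearrange t s q ⟩
    suc q + s + t        ≤⟨ +-monoˡ-≤ t (+-monoʳ-≤ (suc q) (s≤s*m s)) ⟩
    suc q + s * m + t    ≡⟨ cong (_+ t) a≡ ⟨
    a + t                ∎))
    where
    open ≤-Reasoning
    rearrange : ∀ t s q → t + s + suc q ≡ suc q + s + t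
    rearrange = solve-∀
    expand : ∀ q t s m → suc q + (t + s) * m + 0 ≡ suc q + s * m + t * m
    expand = solve-∀
    a≡ : a ≡ suc q + s * m
    a≡ = +-cancelʳ-≡ (t * m) a (suc q + s * m) (trans eq (expand q t s m))
  aligned a t (suc zero) <g eq | inj₂ p<t with m≤n⇒∃[o]m+o≡n p<t
  ... | s , refl = contradiction (≤-trans (m≤n+m m (a + s * m)) (≤-reflexive m+≡)) m≰1+q
    where
    expand : ∀ a p s m → a + (suc p + s) * m ≡ a + s * m + m + p * m
    expand = solve-∀
    m+≡ : a + s * m + m ≡ suc q
    m+≡ = +-cancelʳ-≡ (p * m) _ (suc q) (trans (sym (expand a p s m)) (trans eq (+-identityʳ N)))

  -- Undoing even one edge takes `m` arcs, so there are at least `m + 1 = suc q + suc q` steps,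
  -- which is no less than `g`.
  ¬arcs-undo-edges : ∀ a t k → a + suc t < g → a ≢ suc t * m + k * N
  ¬arcs-undo-edges a t k <g eq = contradiction <g (≤⇒≯ (begin
    p + suc q          ≤⟨ +-monoˡ-≤ (suc q) p≤1+q ⟩
    suc q + suc q      ≡⟨ +-comm 1 m ⟩
    m + 1              ≤⟨ +-mono-≤ m≤a (s≤s z≤n) ⟩
    a + suc t          ∎))
    where
    open ≤-Reasoning
    m≤a : m ≤ a
    m≤a = ≤-trans (m≤m*t {suc t} (s≤s z≤n))
            (≤-trans (m≤m+n (suc t * m) (k * N)) (≤-reflexive (sym eq)))

  -- Arcs and edges pull in opposite directions. Arcs are too few to undo an edge, edges are too few
  -- to reach twice `N`, and for `N` itself more than `p` edges are required.
  opposed : ∀ a t k → a + t < g → a ≡ t * m + k * N ⊎ t * m ≡ a + k * N → a ≡ 0 × t ≡ 0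
  opposed a zero    k <g (inj₁ eq) = aligned a 0 k <g (trans (+-identityʳ a) eq)
  opposed a (suc t) k <g (inj₁ eq) = contradiction eq (¬arcs-undo-edges a t k <g)
  opposed a zero    k <g (inj₂ eq) = m+n≡0⇒m≡0 a (sym eq) , refl
  opposed a (suc t) zero <g (inj₂ eq) =
    contradiction (trans (sym (+-identityʳ a)) (trans (sym eq) (sym (+-identityʳ (suc t * m))))) (¬arcs-undo-edges a t 0 <g)
  opposed a t@(suc _) (suc (suc k)) <g (inj₂ eq) =
    contradiction (≤-trans (below-2N a t k <g) (≤-trans (m≤n+m (suc (suc k) * N) a) (≤-reflexive (sym eq))))
                  (≤⇒≯ (m≤n+m (t * m) a))
  opposed a t@(suc _) (suc zero) <g (inj₂ eq) with ≤-<-connex t p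
  ... | inj₁ t≤p = contradiction (begin-strict
    t * m           ≤⟨ *-monoˡ-≤ m t≤p ⟩
    p * m           <⟨ s≤s (m≤n+m (p * m) q) ⟩
    N               ≡⟨ +-identityʳ N ⟨
    1 * N           ≤⟨ m≤n+m (1 * N) a ⟩
    a + 1 * N       ≡⟨ eq ⟨
    t * m           ∎) (<-irrefl refl)
    where open ≤-Reasoning
  -- `suc p` edges overshoot `N` by `m ∸ suc q = q`, so at least `q` arcs are needed to compensate:
  -- the second generator of the lattice, of norm exactly `g`.
  ... | inj₂ p<t with m≤n⇒∃[o]m+o≡n p<t
  ...   | s , refl = contradiction <g (≤⇒≯ (begin
    p + suc q          ≡⟨ rearrange p q ⟩
    q + suc p          ≤⟨ +-mono-≤ q≤a (m≤m+n (suc p) s) ⟩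
    a + (suc p + s)    ∎))
    where
    open ≤-Reasoning
    rearrange : ∀ p q → p + suc q ≡ q + suc p
    rearrange = solve-∀
    expandˡ : ∀ p s m → (suc p + s) * m ≡ m + s * m + p * m
    expandˡ = solve-∀
    expandʳ : ∀ a q p m → a + 1 * (suc q + p * m) ≡ a + suc q + p * m
    expandʳ = solve-∀
    m+≡ : m + s * m ≡ a + suc q
    m+≡ = +-cancelʳ-≡ (p * m) _ (a + suc q) (trans (sym (expandˡ p s m)) (trans eq (expandʳ a q p m)))
    q≤a : q ≤ a
    q≤a = +-cancelʳ-≤ (suc q) q a (≤-trans (m≤m+n m (s * m)) (≤-reflexive m+≡))

  -- Cancelling the smaller of `b` and `c` leaves edges in one direction: against the arcs when
  -- `b ≤ c`, along them otherwise.
  short : ∀ a b c k → a + b + c < g →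
          a + b * m ≡ c * m + k * N ⊎ c * m ≡ a + b * m + k * N → a ≡ 0 × b ≡ c
  short a b c k <g eq with ≤-total b c
  ... | inj₁ b≤c with m≤n⇒∃[o]m+o≡n b≤c
  ...   | t , refl = finish (opposed a t k (≤-<-trans drop <g) (cancel eq))
    where
    finish : a ≡ 0 × t ≡ 0 → a ≡ 0 × b ≡ b + t
    finish (a≡0 , refl) = a≡0 , sym (+-identityʳ b)
    drop : a + t ≤ a + b + (b + t)
    drop = +-mono-≤ (m≤m+n a b) (m≤n+m t b)
    expand₁ : ∀ b t m x → (b + t) * m + x ≡ b * m + (t * m + x)
    expand₁ = solve-∀
    expand₂ : ∀ a y x → a + y + x ≡ y + (a + x)
    expand₂ = solve-∀
    cancel : a + b * m ≡ (b + t) * m + k * N ⊎ (b + t) * m ≡ a + b * m + k * N →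
             a ≡ t * m + k * N ⊎ t * m ≡ a + k * N
    cancel (inj₁ e) = inj₁ (+-cancelˡ-≡ (b * m) a _ (trans (+-comm (b * m) a) (trans e (expand₁ b t m (k * N)))))
    cancel (inj₂ e) = inj₂ (+-cancelˡ-≡ (b * m) (t * m) _
      (trans (sym (*-distribʳ-+ m b t)) (trans e (expand₂ a (b * m) (k * N)))))
  short a b c k <g eq | inj₂ c≤b with m≤n⇒∃[o]m+o≡n c≤b
  ... | t , refl = finish (cancel eq)
    where
    finish : a ≡ 0 × t ≡ 0 → a ≡ 0 × c + t ≡ c
    finish (a≡0 , refl) = a≡0 , +-identityʳ c
    drop : a + t ≤ a + (c + t) + c
    drop = ≤-trans (+-monoʳ-≤ a (m≤n+m t c)) (m≤m+n _ c)
    expand₁ : ∀ a c t m → c * m + (a + t * m) ≡ a + (c + t) * m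
    expand₁ = solve-∀
    expand₂ : ∀ a c t m x → a + (c + t) * m + x ≡ c * m + (a + t * m + x)
    expand₂ = solve-∀
    cancel : a + (c + t) * m ≡ c * m + k * N ⊎ c * m ≡ a + (c + t) * m + k * N → a ≡ 0 × t ≡ 0
    cancel (inj₁ e) = aligned a t k (≤-<-trans drop <g)
      (+-cancelˡ-≡ (c * m) (a + t * m) (k * N) (trans (expand₁ a c t m) e))
    -- Here `a + t * m + k * N` is zero, so `aligned` is used with the multiple 0.
    cancel (inj₂ e) = aligned a t 0 (≤-<-trans drop <g)
      (m+n≡0⇒m≡0 (a + t * m) (+-cancelˡ-≡ (c * m) _ 0
        (trans (sym (expand₂ a c t m (k * N))) (trans (sym e) (sym (+-identityʳ (c * m)))))))

  -- The circulant graph attains the lower bound and so is a cage. Any other cage is no larger by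
  -- its minimality against `graph`, and no smaller by the bound.
  cageOrder : mooreBound g ≡ N → CageOrder[ 1 , 2 ⨾ g ] N
  cageOrder bound≡N = (graph , cage) , λ G isCage → let open Is[_,_⨾_]-MixedCage isCage in
      ≤-antisym (minimal graph regular) (≥N G isMixedGraph)
    where
    2<g : 2 < g
    2<g = +-mono-≤ (≤-trans 1≤q q≤p) (s≤s 1≤q)
    open Circulant N m g p q 2<g refl refl short
    ≥N : ∀ {n} (G : MixedGraph n) → Is[ 1 , 2 ⨾ g ]-MixedGraph G → N ≤ n
    ≥N G reg = ≤-trans (≤-reflexive (sym bound≡N)) (LowerBound.mooreBound≤order G reg)
    cage : Is[ 1 , 2 ⨾ g ]-MixedCage graph
    cage = record { isMixedGraph = regular ; minimal = ≥N }

-- Odd and even girth.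

theorem7 : ∀ (g : ℕ) → 3 ≤ g →
    (2 ∤ g → CageOrder[ 1 , 2 ⨾ g ] ((g ^ 2 + 1) / 2))
    × (2 ∣ g → CageOrder[ 1 , 2 ⨾ g ] (g ^ 2 / 2))
theorem7 g 3≤g = odd , even
  where
  halve : ∀ {a} N → a ≡ N * 2 → a / 2 ≡ N
  halve N refl = m*n/n≡m N 2

  odd-order : ∀ p → 3 ≤ 1 + p * 2 → CageOrder[ 1 , 2 ⨾ 1 + p * 2 ] (((1 + p * 2) ^ 2 + 1) / 2)
  odd-order zero      (s≤s ())
  odd-order p@(suc _) _ = subst₂ (CageOrder[ 1 , 2 ⨾_]) (girth≡ p) (sym (halve N (square p)))
    (cageOrder (trans (mooreBound-odd p) (order≡ p)))
    where
    -- The girth `1 + p * 2` splits into the halves `p` and `suc p`.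
    open Arithmetic p p (s≤s z≤n) (n≤1+n p) ≤-refl
    girth≡ : ∀ p → p + suc p ≡ 1 + p * 2
    girth≡ = solve-∀
    -- The left side is how the square `_^ 2` unfolds; the factor 2 stands on the right for `halve`.
    square : ∀ p → (1 + p * 2) * ((1 + p * 2) * 1) + 1 ≡ (suc p + p * (p + suc p)) * 2
    square = solve-∀
    order≡ : ∀ p → p * p + suc p * suc p ≡ suc p + p * (p + suc p)
    order≡ = solve-∀

  even-order : ∀ p → 3 ≤ p * 2 → CageOrder[ 1 , 2 ⨾ p * 2 ] ((p * 2) ^ 2 / 2)
  even-order (suc zero)      (s≤s (s≤s ()))
  even-order (suc q@(suc _)) _ = subst₂ (CageOrder[ 1 , 2 ⨾_]) (girth≡ q) (sym (halve N (square q)))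
    (cageOrder (trans (mooreBound-even (suc q)) (order≡ q)))
    where
    -- Both halves of the girth are `suc q`, and `3 ≤ g` has ruled out `q = 0`.
    open Arithmetic (suc q) q (s≤s z≤n) ≤-refl (n≤1+n q)
    girth≡ : ∀ q → suc q + suc q ≡ suc q * 2
    girth≡ = solve-∀
    square : ∀ q → (suc q * 2) * ((suc q * 2) * 1) ≡ (suc q + suc q * (q + suc q)) * 2
    square = solve-∀
    order≡ : ∀ q → suc q * suc q + suc q * suc q ≡ suc q + suc q * (q + suc q)
    order≡ = solve-∀

  odd : 2 ∤ g → CageOrder[ 1 , 2 ⨾ g ] ((g ^ 2 + 1) / 2)
  odd 2∤g with g % 2 | m≡m%n+[m/n]*n g 2 | m%n<n g 2
  ... | 0           | g≡ | _ = contradiction (divides (g / 2) g≡) 2∤g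
  ... | 1           | g≡ | _ = subst (λ g → CageOrder[ 1 , 2 ⨾ g ] ((g ^ 2 + 1) / 2)) (sym g≡)
                                 (odd-order (g / 2) (subst (3 ≤_) g≡ 3≤g))
  ... | suc (suc _) | _  | s≤s (s≤s ())

  even : 2 ∣ g → CageOrder[ 1 , 2 ⨾ g ] (g ^ 2 / 2)
  even (divides p refl) = even-order p 3≤g
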